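{- For every $n\ge 2$ and every orientation $\bar G$ of the type $A_{n-1}$ Coxeter diagram, the type $A$ Cambrian lattice $C(\bar G)$ is trim. Equivalently, the set $\mathcal B$ of permutations in $S_n$ avoiding the patterns $\bar 231$ and $31\underline 2$, ordered by weak order, is a trim lattice.
   Context: For $\pi\in S_n$ written as the word $\pi_1\cdots\pi_n$, its inversion set is $\{e_j-e_i: i<j,\ j\text{ precedes } i\text{ in }\pi_1\cdots\pi_n\}$; weak order is inclusion of inversion sets, and is a lattice. The Coxeter diagram is a path $s_1,\dots,s_{n-1}$; an orientation $\bar G$ chooses for each $2\le i\le n-1$ either $s_{i-1}\to s_i$ or $s_{i-1}\leftarrow s_i$. Let $D=\{i\in[2,n-1]: s_{i-1}\to s_i\}$ and $U=\{i\in[2,n-1]: s_{i-1}\leftarrow s_i\}$. A permutation $\pi$ contains $\bar 231$ if there are positions $p<q<r$ with $\pi_r<\pi_p<\pi_q$ and $\pi_p\in U$; it contains $31\underline 2$ if there are positions $p<q<r$ with $\pi_q<\pi_r<\pi_p$ and $\pi_r\in D$. By a result of Reading, $\mathcal B$ is a sublattice of weak order isomorphic to the Cambrian lattice $C(\bar G)$ (a lattice quotient of weak order on $S_n$ whose fibres have minimal elements exactly $\mathcal B$). A finite lattice is trim if, for some $m$, it has a maximal chain of $m+1$ left modular elements (an element $x$ is left modular if $(y\vee x)\wedge z=y\vee(x\wedge z)$ for all $y<z$) and has exactly $m$ join-irreducibles and exactly $m$ meet-irreducibles. -}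

module Defs where

open import Level using (Level; _⊔_)
open import Data.Nat using (ℕ; zero; suc)
open import Data.Fin using (Fin; toℕ; fromℕ; inject₁; _<_)
import Data.Fin as F
open import Data.Bool using (Bool; true; false)
open import Data.List using (List; length)
open import Data.List.Relation.Unary.All using (All)
open import Data.List.Relation.Unary.Any using (Any)
open import Data.List.Relation.Unary.AllPairs using (AllPairs)
open import Data.Product using (Σ; ∃; _×_; _,_)
open import Data.Sum using (_⊎_)
open import Relation.Nullary using (¬_)
open import Relation.Binary.PropositionalEquality using (_≡_)
open import Relation.Binary.Core using (Rel)
open import Function.Definitions using (Injective)
import Relation.Binary.Lattice.Structures as LS

module _ {a ℓ₁ ℓ₂ : Level} {A : Set a} (_≈_ : Rel A ℓ₁) (_≤_ : Rel A ℓ₂) where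

  _<ₚ_ : Rel A ℓ₂
  x <ₚ y = x ≤ y × ¬ (y ≤ x)

  Covers : A → A → Set _
  Covers x y = x <ₚ y × (∀ z → x <ₚ z → ¬ (z <ₚ y))

  FiniteCarrier : Set _
  FiniteCarrier = Σ (List A) λ l → ∀ x → Any (x ≈_) l

  HasExactly : ∀ {p} → ℕ → (A → Set p) → Set _
  HasExactly m P =
    Σ (List A) λ l → length l ≡ m × All P l × AllPairs (λ u v → ¬ (u ≈ v)) l
                     × (∀ x → P x → Any (x ≈_) l)

  module _ (_∨_ _∧_ : A → A → A) where

    JoinIrreducible : A → Set _
    JoinIrreducible x = ¬ (∀ y → x ≤ y) × (∀ y z → x ≈ (y ∨ z) → x ≈ y ⊎ x ≈ z)

    MeetIrreducible : A → Set _
    MeetIrreducible x = ¬ (∀ y → y ≤ x) × (∀ y z → x ≈ (y ∧ z) → x ≈ y ⊎ x ≈ z)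

    LeftModular : A → Set _
    LeftModular x = ∀ y z → y <ₚ z → ((y ∨ x) ∧ z) ≈ (y ∨ (x ∧ z))

    LeftModularMaximalChain : ℕ → Set _
    LeftModularMaximalChain m =
      Σ (Fin (suc m) → A) λ c →
          (∀ y → c F.zero ≤ y)
        × (∀ y → y ≤ c (fromℕ m))
        × (∀ (i : Fin m) → Covers (c (inject₁ i)) (c (F.suc i)))
        × (∀ i → LeftModular (c i))

  IsTrimLattice : Set _
  IsTrimLattice =
    Σ (A → A → A) λ _∨_ → Σ (A → A → A) λ _∧_ →
        LS.IsLattice _≈_ _≤_ _∨_ _∧_
      × FiniteCarrier
      × Σ ℕ λ m →
            LeftModularMaximalChain _∨_ _∧_ m
          × HasExactly m (JoinIrreducible _∨_ _∧_)
          × HasExactly m (MeetIrreducible _∨_ _∧_)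

-- A permutation of [n] as a word: position p ↦ letter π p.
-- Positions and letters are Fin n; letter v stands for the number toℕ v + 1.
Perm : ℕ → Set
Perm n = Σ (Fin n → Fin n) Injective′
  where Injective′ = Injective _≡_ _≡_

word : ∀ {n} → Perm n → Fin n → Fin n
word (π , _) = π

Precedes : ∀ {n} → Perm n → Fin n → Fin n → Set
Precedes π b a = Σ (Fin _) λ p → Σ (Fin _) λ q → p < q × word π p ≡ b × word π q ≡ a

_≤w_ : ∀ {n} → Perm n → Perm n → Set
π ≤w σ = ∀ a b → a < b → Precedes π b a → Precedes σ b a

_≈w_ : ∀ {n} → Perm n → Perm n → Set
π ≈w σ = ∀ p → word π p ≡ word σ p

-- Orientation of the diagram s₁ — … — s_{n-1} for n = k + 2:
-- o j (j : Fin k) concerns i = toℕ j + 2 ∈ [2, n-1];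
-- o j ≡ true means s_{i-1} → s_i (i ∈ D), false means s_{i-1} ← s_i (i ∈ U).
Orientation : ℕ → Set
Orientation k = Fin k → Bool

InD : ∀ {k} → Orientation k → Fin (suc (suc k)) → Set
InD {k} o v = Σ (Fin k) λ j → toℕ v ≡ suc (toℕ j) × o j ≡ true

InU : ∀ {k} → Orientation k → Fin (suc (suc k)) → Set
InU {k} o v = Σ (Fin k) λ j → toℕ v ≡ suc (toℕ j) × o j ≡ false

Contains231 : ∀ {k} → Orientation k → Perm (suc (suc k)) → Set
Contains231 o π =
  Σ (Fin _) λ p → Σ (Fin _) λ q → Σ (Fin _) λ r →
    p < q × q < r × word π r < word π p × word π p < word π q × InU o (word π p)

Contains312 : ∀ {k} → Orientation k → Perm (suc (suc k)) → Set
Contains312 o π =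
  Σ (Fin _) λ p → Σ (Fin _) λ q → Σ (Fin _) λ r →
    p < q × q < r × word π q < word π r × word π r < word π p × InD o (word π r)

CambrianPerm : ∀ {k} → Orientation k → Set
CambrianPerm {k} o = Σ (Perm (suc (suc k))) λ π → ¬ Contains231 o π × ¬ Contains312 o π

_≤B_ : ∀ {k} {o : Orientation k} → CambrianPerm o → CambrianPerm o → Set
(π , _) ≤B (σ , _) = π ≤w σ

_≈B_ : ∀ {k} {o : Orientation k} → CambrianPerm o → CambrianPerm o → Set
(π , _) ≈B (σ , _) = π ≈w σ

{-# OPTIONS --safe #-}
module Submission where

-- Since every letter strictly between a < c lies in U or D, the elements of B are exactly the
-- sets I of pairs (a,c) closed under ab, bc ∈ I ⇒ ac ∈ I, under ac ∈ I ⇒ bc ∈ I for b ∈ U, and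
-- under ac ∈ I ⇒ ab ∈ I for b ∈ D (a < b < c).  These conditions are Horn clauses, so meets are
-- intersections.
--
-- Let J(a,c) be the set of pairs (u,v) inside [a,c] with u = a or u ∈ U, and v = c or v ∈ D, let
-- K(a,c) be the same with U and D exchanged, and write p ⟶ q when J(p) meets K(q).  The J(p) are
-- the join-irreducibles, the sets M(q) = {p : ¬ p ⟶ q} are the meet-irreducibles, and everything
-- rests on one separation property: if p ∉ I, then some q ∈ J(p) has K(q) disjoint from I (such a
-- q satisfies p ⟶ q).  The relation ⟶ is acyclic, and adding the pairs one by one along a
-- linear extension of it gives the chain.  A set x closed under ⟶ is left modular: if
-- p ∈ (y ∨ x) ∧ z were not in w = y ∨ (x ∧ z), take q ∈ J(p) separating p from w; then q ∈ z, and
-- q ∈ x would put q in w, while q ∉ x makes M(q) an upper bound of y ∨ x, although p ⟶ q.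

open import Defs
open import Level using (0ℓ)
open import Data.Bool.Base using (true; false)
import Data.Bool.Properties as Bool
open import Data.Nat using (ℕ)
open import Data.Nat.Base as ℕ using (suc; s≤s)
import Data.Nat.Properties as ℕ
open import Data.Fin.Base as F using (Fin; zero; suc; toℕ; fromℕ; fromℕ<; inject₁)
import Data.Fin.Properties as F
open import Data.Fin.Subset using (Subset; _∈_; ⁅_⁆; inside; outside; ∣_∣)
open import Data.Fin.Subset.Properties
  using (_∈?_; x∈⁅x⁆; x∈⁅y⁆⇒x≡y; p⊂q⇒∣p∣<∣q∣; ∣⊤∣≡n; ∈⊤)
open import Data.List.Base as List
  using (List; []; _∷_; foldr; filter; allFin; length; cartesianProduct)
open import Data.List.Properties using (length-tabulate)
open import Data.List.Membership.Propositional using () renaming (_∈_ to _∈ˡ_)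
open import Data.List.Membership.Propositional.Properties
  using (∈-filter⁺; ∈-filter⁻; ∈-allFin; ∈-map⁺; ∈-++⁺ˡ; ∈-++⁺ʳ; ∈-lookup; ∈-cartesianProduct⁺)
open import Data.List.Relation.Binary.Permutation.Propositional using (↭-sym; ↭⇒↭ₛ)
open import Data.List.Relation.Binary.Permutation.Propositional.Properties using (∈-resp-↭)
import Data.List.Relation.Binary.Permutation.Setoid.Properties as Permutation
open import Data.List.Relation.Unary.All as All using (All)
import Data.List.Relation.Unary.All.Properties as All
open import Data.List.Relation.Unary.AllPairs using (AllPairs; _∷_)
import Data.List.Relation.Unary.AllPairs.Properties as AllPairs
open import Data.List.Relation.Unary.Any as Any using (Any; here; there)
import Data.List.Relation.Unary.Any.Properties as Any
open import Data.List.Relation.Unary.Sorted.TotalOrder.Properties using (lookup-mono-≤)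
open import Data.List.Relation.Unary.Unique.Propositional using (Unique)
import Data.List.Relation.Unary.Unique.Propositional.Properties as Unique
import Data.List.Sort as Sort
open import Data.Product using (∃; ∃₂; _×_; _,_; proj₁; proj₂)
open import Data.Sum using (_⊎_; inj₁; inj₂; [_,_]′)
import Data.Sum as Sum
import Data.Vec.Base as Vec
open import Data.Vec.Properties using (lookup∘tabulate; lookup⇒[]=; []=⇒lookup)
open import Function.Base using (_∘_; const; id)
open import Function.Definitions using (Injective)
open import Relation.Binary.Bundles using (DecTotalOrder)
import Relation.Binary.Construct.On as On
open import Relation.Binary.Core using (Rel)
import Relation.Binary.Definitions as B
open import Relation.Binary.Definitions using (Transitive; tri<; tri≈; tri>)
import Relation.Binary.Lattice.Structures as LS
open import Relation.Binary.PropositionalEquality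
  using (_≡_; _≢_; refl; sym; trans; cong; cong₂; subst; subst₂; setoid)
open import Relation.Binary.Structures using (IsPartialOrder)
open import Relation.Nullary using (¬_; Dec; yes; no; does; contradiction)
open import Relation.Nullary.Decidable
  using (¬?; _→-dec_; _×-dec_; _⊎-dec_; map′; dec-true)
open import Relation.Unary using (Pred; Decidable)

-- Decidable subsets of a finite set

⟪_⟫ : ∀ {m} {P : Pred (Fin m) 0ℓ} → Decidable P → Subset m
⟪ P? ⟫ = Vec.tabulate (does ∘ P?)

module _ {m} {P : Pred (Fin m) 0ℓ} (P? : Decidable P) where

  ∈⟪⟫⁺ : ∀ {i} → P i → i ∈ ⟪ P? ⟫
  ∈⟪⟫⁺ {i} pi = lookup⇒[]= i _ (trans (lookup∘tabulate _ i) (dec-true (P? i) pi))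

  ∈⟪⟫⁻ : ∀ {i} → i ∈ ⟪ P? ⟫ → P i
  ∈⟪⟫⁻ {i} i∈ with P? i | trans (sym (lookup∘tabulate (does ∘ P?) i)) ([]=⇒lookup i∈)
  ... | yes pi | _ = pi

allSubsets : ∀ m → List (Subset m)
allSubsets ℕ.zero  = Vec.[] ∷ []
allSubsets (suc m) =
  List.map (inside Vec.∷_) (allSubsets m) List.++ List.map (outside Vec.∷_) (allSubsets m)

∈-allSubsets : ∀ {m} (s : Subset m) → s ∈ˡ allSubsets m
∈-allSubsets Vec.[]            = here refl
∈-allSubsets (true Vec.∷ s)  = ∈-++⁺ˡ (∈-map⁺ _ (∈-allSubsets s))
∈-allSubsets (false Vec.∷ s) = ∈-++⁺ʳ _ (∈-map⁺ _ (∈-allSubsets s))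

-- An abstract criterion for trimness

-- J p and ⋀ ⁅ q ⁆ are the intended join- and meet-irreducibles.
record Presentation {A : Set} (_≈_ _≤_ : Rel A 0ℓ) : Set₁ where
  field
    isPartialOrder : IsPartialOrder _≈_ _≤_
    m              : ℕ
    _∋_            : A → Fin m → Set
    _∋?_           : ∀ x p → Dec (x ∋ p)
    ≤⇒∋            : ∀ {x y p} → x ≤ y → x ∋ p → y ∋ p
    ∋⇒≤            : ∀ {x y} → (∀ p → x ∋ p → y ∋ p) → x ≤ y

    _⊑_            : Rel (Fin m) 0ℓ
    ∋-down         : ∀ {x p q} → q ⊑ p → x ∋ p → x ∋ q
    J              : Fin m → A
    J∋⁺            : ∀ {p q} → q ⊑ p → J p ∋ q
    J∋⁻            : ∀ {p q} → J p ∋ q → q ⊑ p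

    _⟶_            : Rel (Fin m) 0ℓ
    _⟶?_           : ∀ p q → Dec (p ⟶ q)
    ⟶-refl         : ∀ p → p ⟶ p
    ⟶-sorted       : ∀ {p q} → p F.< q → ¬ p ⟶ q
    ⋀              : Subset m → A
    ⋀∋⁺            : ∀ {Q p} → (∀ q → q ∈ Q → ¬ p ⟶ q) → ⋀ Q ∋ p
    ⋀∋⁻            : ∀ {Q p q} → ⋀ Q ∋ p → q ∈ Q → ¬ p ⟶ q

    separation     : ∀ {x p} → ¬ x ∋ p →
                     ∃ λ q → q ⊑ p × p ⟶ q × (∀ r → x ∋ r → ¬ r ⟶ q)
    ⊑∧⟶⇒⊒          : ∀ {p q} → q ⊑ p → q ⟶ p → p ⊑ q
    -- The hypothesis on x says that x lies above the largest element missing q.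
    ⟶-target       : ∀ {x p q} → (∀ r → ¬ r ⟶ q → x ∋ r) → p ⟶ q → x ∋ p → x ∋ q

module _ {A : Set} {_≈_ _≤_ : Rel A 0ℓ} (presentation : Presentation _≈_ _≤_) where

  open Presentation presentation
  private module PO = IsPartialOrder isPartialOrder

  -- x lies below the meet-irreducible of q.
  Misses : A → Fin m → Set
  Misses x q = ∀ r → x ∋ r → ¬ r ⟶ q

  misses? : ∀ x q → Dec (Misses x q)
  misses? x q = F.all? λ r → (x ∋? r) →-dec ¬? (r ⟶? q)

  ⋀-by : ∀ {Q : Pred (Fin m) 0ℓ} → Decidable Q → A
  ⋀-by Q? = ⋀ ⟪ Q? ⟫

  module _ {Q : Pred (Fin m) 0ℓ} (Q? : Decidable Q) where

    ⋀-by∋⁺ : ∀ {p} → (∀ q → Q q → ¬ p ⟶ q) → ⋀-by Q? ∋ p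
    ⋀-by∋⁺ h = ⋀∋⁺ λ q q∈ → h q (∈⟪⟫⁻ Q? q∈)

    ⋀-by∋⁻ : ∀ {p q} → ⋀-by Q? ∋ p → Q q → ¬ p ⟶ q
    ⋀-by∋⁻ ∋p Qq = ⋀∋⁻ ∋p (∈⟪⟫⁺ Q? Qq)

  -- By `separation`, x is the meet of the elements `⋀ ⁅ q ⁆` above it, so membership can be tested
  -- on these alone.
  misses-all⇒∋ : ∀ {x p} → (∀ q → Misses x q → ¬ p ⟶ q) → x ∋ p
  misses-all⇒∋ {x} {p} h with x ∋? p
  ... | yes x∋p = x∋p
  ... | no  x∌p = let q , _ , p⟶q , x-q = separation x∌p in contradiction p⟶q (h q x-q)

  both-miss? : ∀ x y q → Dec (Misses x q × Misses y q)
  both-miss? x y q = misses? x q ×-dec misses? y q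

  either-misses? : ∀ x y q → Dec (Misses x q ⊎ Misses y q)
  either-misses? x y q = misses? x q ⊎-dec misses? y q

  infixr 6 _∨_
  infixr 7 _∧_

  -- The q missed by the join are to include those that x and y both miss. The meet is built in the
  -- same way so as to be an element of `A`; `∧∋⁺` and `∧∋⁻` identify it with the intersection.
  _∨_ _∧_ : A → A → A
  x ∨ y = ⋀-by (both-miss? x y)
  x ∧ y = ⋀-by (either-misses? x y)

  ∨-misses : ∀ {x y q} → Misses x q → Misses y q → Misses (x ∨ y) q
  ∨-misses {x} {y} x-q y-q r ∋r = ⋀-by∋⁻ (both-miss? x y) ∋r (x-q , y-q)

  ∧∋⁺ : ∀ {x y p} → x ∋ p → y ∋ p → (x ∧ y) ∋ p
  ∧∋⁺ {x} {y} x∋p y∋p = ⋀-by∋⁺ (either-misses? x y) λ q →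
    [ (λ x-q → x-q _ x∋p) , (λ y-q → y-q _ y∋p) ]′

  ∧∋⁻ : ∀ {x y p} → (x ∧ y) ∋ p → x ∋ p × y ∋ p
  ∧∋⁻ {x} {y} ∋p = misses-all⇒∋ (λ q x-q → ⋀-by∋⁻ (either-misses? x y) ∋p (inj₁ x-q))
         , misses-all⇒∋ (λ q y-q → ⋀-by∋⁻ (either-misses? x y) ∋p (inj₂ y-q))

  isLattice : LS.IsLattice _≈_ _≤_ _∨_ _∧_
  isLattice = record
    { isPartialOrder = isPartialOrder
    ; supremum = λ x y →
          ∋⇒≤ (λ p x∋p → ⋀-by∋⁺ (both-miss? x y) λ q (x-q , _) → x-q p x∋p)
        , ∋⇒≤ (λ p y∋p → ⋀-by∋⁺ (both-miss? x y) λ q (_ , y-q) → y-q p y∋p)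
        , λ z x≤z y≤z → ∋⇒≤ λ p ∋p → misses-all⇒∋ λ q z-q →
            ∨-misses (λ r → z-q r ∘ ≤⇒∋ x≤z) (λ r → z-q r ∘ ≤⇒∋ y≤z) p ∋p
    ; infimum = λ x y →
          ∋⇒≤ (λ p → proj₁ ∘ ∧∋⁻)
        , ∋⇒≤ (λ p → proj₂ ∘ ∧∋⁻)
        , λ z z≤x z≤y → ∋⇒≤ λ p z∋p → ∧∋⁺ (≤⇒∋ z≤x z∋p) (≤⇒∋ z≤y z∋p)
    }

  open LS.IsLattice isLattice using (x≤x∨y; y≤x∨y; ∨-least; x∧y≤x; x∧y≤y; ∧-greatest; antisym)

  -- Every x is `⋀` of the set of all q that it misses, so the subsets of `Fin m` exhaust the
  -- carrier, possibly with repetitions.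
  finiteCarrier : FiniteCarrier _≈_ _≤_
  finiteCarrier = List.map ⋀ (allSubsets m) , λ x →
    Any.map⁺ (Any.map (λ { refl → antisym
      (∋⇒≤ λ p x∋p → ⋀-by∋⁺ (misses? x) λ q x-q → x-q p x∋p)
      (∋⇒≤ λ p ∋p → misses-all⇒∋ λ q x-q → ⋀-by∋⁻ (misses? x) ∋p x-q) })
      (∈-allSubsets ⟪ misses? x ⟫))

  -- Left modularity and the maximal chain

  -- The hypothesis is closure of x under `⟶`: if q is not in x, then no member of x has an arrow to
  -- q.
  leftModular : ∀ {x} → (∀ q → x ∋ q ⊎ Misses x q) → LeftModular _≈_ _≤_ _∨_ _∧_ x
  leftModular {x} dichotomy y z (y≤z , _) = antisym (∋⇒≤ ⊆) ⊇
    where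
    ⊇ : (y ∨ (x ∧ z)) ≤ ((y ∨ x) ∧ z)
    ⊇ = ∨-least (∧-greatest (x≤x∨y y x) y≤z)
                (∧-greatest (PO.trans (x∧y≤x x z) (y≤x∨y y x)) (x∧y≤y x z))

    ⊆ : ∀ p → ((y ∨ x) ∧ z) ∋ p → (y ∨ (x ∧ z)) ∋ p
    ⊆ p ∋p with (y ∨ (x ∧ z)) ∋? p
    ... | yes w∋p = w∋p
    ... | no  w∌p with separation w∌p
    ... | q , q⊑p , p⟶q , w-q with dichotomy q
    ...   | inj₁ x∋q = contradiction (⟶-refl q)
                         (w-q q (≤⇒∋ (y≤x∨y y (x ∧ z)) (∧∋⁺ x∋q (∋-down q⊑p (proj₂ (∧∋⁻ ∋p))))))
    ...   | inj₂ x-q = contradiction p⟶q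
                         (∨-misses (λ r → w-q r ∘ ≤⇒∋ (x≤x∨y y (x ∧ z))) x-q p (proj₁ (∧∋⁻ ∋p)))

  -- No arrow leads to a larger index, so this meet contains every p < i; by `⟶-refl` it contains
  -- nothing else. Such initial segments are closed under `⟶`.
  below : Fin (suc m) → A
  below i = ⋀-by (i F.≤?_)

  below∋⁺ : ∀ i {p} → toℕ p ℕ.< toℕ i → below i ∋ p
  below∋⁺ i p<i = ⋀-by∋⁺ (i F.≤?_) λ q i≤q → ⟶-sorted (ℕ.≤-trans p<i i≤q)

  below-misses : ∀ i {q} → toℕ i ℕ.≤ toℕ q → Misses (below i) q
  below-misses i i≤q r ∋r = ⋀-by∋⁻ (i F.≤?_) ∋r i≤q

  below∋⁻ : ∀ i {p} → below i ∋ p → toℕ p ℕ.< toℕ i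
  below∋⁻ i ∋p = ℕ.≰⇒> λ i≤p → below-misses i i≤p _ ∋p (⟶-refl _)

  below-covers : ∀ (i : Fin m) → Covers _≈_ _≤_ (below (inject₁ i)) (below (suc i))
  below-covers i = (∋⇒≤ (λ p → below∋⁺ (suc i) ∘ ℕ.m<n⇒m<1+n ∘ <i) , λ ≥ →
      ℕ.<-irrefl refl (<i (≤⇒∋ ≥ (below∋⁺ (suc i) ℕ.≤-refl)))) , between
    where
    <i : ∀ {p} → below (inject₁ i) ∋ p → toℕ p ℕ.< toℕ i
    <i {p} = subst (toℕ p ℕ.<_) (F.toℕ-inject₁ i) ∘ below∋⁻ (inject₁ i)
    i> : ∀ {p} → toℕ p ℕ.< toℕ i → below (inject₁ i) ∋ p
    i> {p} = below∋⁺ (inject₁ i) ∘ subst (toℕ p ℕ.<_) (sym (F.toℕ-inject₁ i))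

    between : ∀ z → _<ₚ_ _≈_ _≤_ (below (inject₁ i)) z → ¬ _<ₚ_ _≈_ _≤_ z (below (suc i))
    -- The two chain members differ only in i, so membership of i in z decides which of them z
    -- equals.
    between z (b≤z , z≰b) (z≤b′ , b′≰z) with z ∋? i
    ... | yes z∋i = b′≰z (∋⇒≤ λ p ∋p → case p (below∋⁻ (suc i) ∋p))
      where
      case : ∀ p → toℕ p ℕ.< suc (toℕ i) → z ∋ p
      case p p≤i with ℕ.m≤n⇒m<n∨m≡n (ℕ.s≤s⁻¹ p≤i)
      ... | inj₁ p<i = ≤⇒∋ b≤z (i> p<i)
      ... | inj₂ p≡i = subst (z ∋_) (F.toℕ-injective (sym p≡i)) z∋i
    ... | no  z∌i = z≰b (∋⇒≤ λ p z∋p → i> (ℕ.≤∧≢⇒<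
        (ℕ.s≤s⁻¹ (below∋⁻ (suc i) (≤⇒∋ z≤b′ z∋p)))
        (λ p≡i → z∌i (subst (z ∋_) (F.toℕ-injective p≡i) z∋p))))

  ⊤ ⊥ : A
  ⊤ = below (fromℕ m)
  ⊥ = below zero

  ⊤∋ : ∀ p → ⊤ ∋ p
  ⊤∋ p = below∋⁺ (fromℕ m) (subst (toℕ p ℕ.<_) (sym (F.toℕ-fromℕ m)) (F.toℕ<n p))

  ⊤-greatest : ∀ y → y ≤ ⊤
  ⊤-greatest y = ∋⇒≤ λ p _ → ⊤∋ p

  ⊥-least : ∀ y → ⊥ ≤ y
  ⊥-least y = ∋⇒≤ λ p ∋p → contradiction (below∋⁻ zero ∋p) λ ()

  leftModularMaximalChain : LeftModularMaximalChain _≈_ _≤_ _∨_ _∧_ m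
  leftModularMaximalChain = below , ⊥-least , ⊤-greatest , below-covers , λ i →
    leftModular λ q → Sum.map (below∋⁺ i) (below-misses i) (ℕ.<-≤-connex (toℕ q) (toℕ i))

  -- Join- and meet-irreducibles

  M : Fin m → A
  M q = ⋀ ⁅ q ⁆

  M∋⁺ : ∀ {q p} → ¬ p ⟶ q → M q ∋ p
  M∋⁺ {q} ¬p⟶q = ⋀∋⁺ λ r r∈ → subst (λ r → ¬ _ ⟶ r) (sym (x∈⁅y⁆⇒x≡y q r∈)) ¬p⟶q

  M-misses : ∀ q → Misses (M q) q
  M-misses q r ∋r = ⋀∋⁻ ∋r (x∈⁅x⁆ q)

  -- If `J p` lacked p, separation would give some q in `J p` that `J p` misses, against `q ⟶ q`.
  ⊑-refl : ∀ {p} → p ⊑ p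
  ⊑-refl {p} with J p ∋? p
  ... | yes ∋p = J∋⁻ ∋p
  ... | no  ∌p with separation ∌p
  ... | q , q⊑p , p⟶q , J-q = contradiction (⟶-refl q) (J-q q (J∋⁺ q⊑p))

  -- By `⊑∧⟶⇒⊒`, an element below `J p` that lacks p even misses p. If y and z both lacked p, their
  -- join would therefore miss p, although it contains p.
  J-joinIrreducible : ∀ p → JoinIrreducible _≈_ _≤_ _∨_ _∧_ (J p)
  J-joinIrreducible p = (λ J≤ → below-misses zero ℕ.z≤n p (≤⇒∋ (J≤ ⊥) (J∋⁺ ⊑-refl)) (⟶-refl p))
    , λ y z J≈ → split y z (PO.reflexive J≈) (PO.reflexive (PO.Eq.sym J≈))
    where
    above : ∀ {x} → x ∋ p → J p ≤ x
    above x∋p = ∋⇒≤ λ q ∋q → ∋-down (J∋⁻ ∋q) x∋p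
    misses : ∀ {x} → x ≤ J p → ¬ x ∋ p → Misses x p
    misses x≤ x∌p r x∋r r⟶p = x∌p (∋-down (⊑∧⟶⇒⊒ (J∋⁻ (≤⇒∋ x≤ x∋r)) r⟶p) x∋r)
    split : ∀ y z → J p ≤ (y ∨ z) → (y ∨ z) ≤ J p → J p ≈ y ⊎ J p ≈ z
    split y z ≤∨ ∨≤ with y ∋? p | z ∋? p
    ... | yes y∋p | _       = inj₁ (antisym (above y∋p) (PO.trans (x≤x∨y y z) ∨≤))
    ... | no _    | yes z∋p = inj₂ (antisym (above z∋p) (PO.trans (y≤x∨y y z) ∨≤))
    ... | no y∌p  | no z∌p  = contradiction (⟶-refl p)
      (∨-misses (misses (PO.trans (x≤x∨y y z) ∨≤) y∌p) (misses (PO.trans (y≤x∨y y z) ∨≤) z∌p)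
        p (≤⇒∋ ≤∨ (J∋⁺ ⊑-refl)))

  -- By `⟶-target`, an element above `M q` that lacks q is also below `M q`. One of y and z lacks q,
  -- since their meet does.
  M-meetIrreducible : ∀ q → MeetIrreducible _≈_ _≤_ _∨_ _∧_ (M q)
  M-meetIrreducible q = (λ ≤M → M-misses q q (≤⇒∋ (≤M ⊤) (⊤∋ q)) (⟶-refl q))
    , λ y z M≈ → split y z (PO.reflexive M≈) (PO.reflexive (PO.Eq.sym M≈))
    where
    under : ∀ {x} → M q ≤ x → ¬ x ∋ q → x ≤ M q
    under M≤x x∌q = ∋⇒≤ λ p x∋p → M∋⁺ λ p⟶q →
      x∌q (⟶-target (λ r → ≤⇒∋ M≤x ∘ M∋⁺) p⟶q x∋p)
    split : ∀ y z → M q ≤ (y ∧ z) → (y ∧ z) ≤ M q → M q ≈ y ⊎ M q ≈ z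
    split y z ≤∧ ∧≤ with y ∋? q | z ∋? q
    ... | no y∌q  | _       = let M≤ = PO.trans ≤∧ (x∧y≤x y z) in inj₁ (antisym M≤ (under M≤ y∌q))
    ... | yes _   | no z∌q  = let M≤ = PO.trans ≤∧ (x∧y≤y y z) in inj₂ (antisym M≤ (under M≤ z∌q))
    ... | yes y∋q | yes z∋q = contradiction (⟶-refl q) (M-misses q q (≤⇒∋ ∧≤ (∧∋⁺ y∋q z∋q)))

  irreducible-foldr : ∀ {X : Set} (_∙_ : A → A → A) (ε : A) (f : X → A) {x} →
    (∀ y z → x ≈ (y ∙ z) → x ≈ y ⊎ x ≈ z) →
    ∀ l → x ≈ foldr (λ a → f a ∙_) ε l → x ≈ ε ⊎ Any (λ a → x ≈ f a) l
  irreducible-foldr _∙_ ε f irr []      x≈ = inj₁ x≈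
  irreducible-foldr _∙_ ε f irr (a ∷ l) x≈ with irr _ _ x≈
  ... | inj₁ x≈fa = inj₂ (here x≈fa)
  ... | inj₂ x≈′  = Sum.map₂ there (irreducible-foldr _∙_ ε f irr l x≈′)

  ⋁J : List (Fin m) → A
  ⋁J = foldr (λ p → J p ∨_) ⊥

  ⋀M : List (Fin m) → A
  ⋀M = foldr (λ q → M q ∧_) ⊤

  ⋁J-upper : ∀ {l p} → p ∈ˡ l → J p ≤ ⋁J l
  ⋁J-upper {p ∷ l} (here refl) = x≤x∨y (J p) (⋁J l)
  ⋁J-upper {p ∷ l} (there p∈l) = PO.trans (⋁J-upper p∈l) (y≤x∨y (J p) (⋁J l))

  ⋁J-least : ∀ {l x} → All (x ∋_) l → ⋁J l ≤ x
  ⋁J-least All.[]          = ⊥-least _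
  ⋁J-least (x∋p All.∷ x∋l) =
    ∨-least (∋⇒≤ λ q ∋q → ∋-down (J∋⁻ ∋q) x∋p) (⋁J-least x∋l)

  ⋀M-lower : ∀ {l q} → q ∈ˡ l → ⋀M l ≤ M q
  ⋀M-lower {q ∷ l} (here refl) = x∧y≤x (M q) (⋀M l)
  ⋀M-lower {q ∷ l} (there q∈l) = PO.trans (x∧y≤y (M q) (⋀M l)) (⋀M-lower q∈l)

  ⋀M-greatest : ∀ {l x} → All (Misses x) l → x ≤ ⋀M l
  ⋀M-greatest All.[]          = ⊤-greatest _
  ⋀M-greatest (x-q All.∷ x-l) =
    ∧-greatest (∋⇒≤ λ p x∋p → M∋⁺ (x-q p x∋p)) (⋀M-greatest x-l)

  -- Every x is the join of the `J p` with p in x, and a join-irreducible must equal one of the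
  -- terms.
  joinIrreducible⇒J : ∀ x → JoinIrreducible _≈_ _≤_ _∨_ _∧_ x → ∃ λ p → x ≈ J p
  joinIrreducible⇒J x (x≰ , irr) with
    irreducible-foldr _∨_ ⊥ J irr (filter (x ∋?_) (allFin m)) x≈
    where
    x≈ : x ≈ ⋁J (filter (x ∋?_) (allFin m))
    x≈ = antisym
      (∋⇒≤ λ p x∋p → ≤⇒∋ (⋁J-upper (∈-filter⁺ (x ∋?_) (∈-allFin p) x∋p)) (J∋⁺ ⊑-refl))
      (⋁J-least (All.all-filter (x ∋?_) (allFin m)))
  ... | inj₁ x≈⊥ = contradiction (λ y → PO.trans (PO.reflexive x≈⊥) (⊥-least y)) x≰
  ... | inj₂ any = Any.satisfied any

  meetIrreducible⇒M : ∀ x → MeetIrreducible _≈_ _≤_ _∨_ _∧_ x → ∃ λ q → x ≈ M q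
  meetIrreducible⇒M x (≰x , irr) with
    irreducible-foldr _∧_ ⊤ M irr (filter (misses? x) (allFin m)) x≈
    where
    x≈ : x ≈ ⋀M (filter (misses? x) (allFin m))
    x≈ = antisym
      (⋀M-greatest (All.all-filter (misses? x) (allFin m)))
      (∋⇒≤ λ p ∋p → misses-all⇒∋ λ q x-q →
        M-misses q p (≤⇒∋ (⋀M-lower (∈-filter⁺ (misses? x) (∈-allFin q) x-q)) ∋p))
  ... | inj₁ x≈⊤ = contradiction
    (λ y → PO.trans (⊤-greatest y) (PO.reflexive (PO.Eq.sym x≈⊤))) ≰x
  ... | inj₂ any = Any.satisfied any

  -- This separates both families: `J q` is not below `M q`, so it differs from `J p`; and `J p` is
  -- not below `M p`, so `M p` differs from `M q`.
  J≤M : ∀ {p q} → p F.< q → J p ≤ M q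
  J≤M {p} {q} p<q = ∋⇒≤ λ r ∋r → ∋-down (J∋⁻ ∋r) (M∋⁺ (⟶-sorted p<q))

  J-distinct : ∀ {p q} → p F.< q → ¬ J p ≈ J q
  J-distinct p<q Jp≈Jq = M-misses _ _
    (≤⇒∋ (PO.trans (PO.reflexive (PO.Eq.sym Jp≈Jq)) (J≤M p<q)) (J∋⁺ ⊑-refl)) (⟶-refl _)

  M-distinct : ∀ {p q} → p F.< q → ¬ M p ≈ M q
  M-distinct p<q Mp≈Mq = M-misses _ _
    (≤⇒∋ (PO.trans (J≤M p<q) (PO.reflexive (PO.Eq.sym Mp≈Mq))) (J∋⁺ ⊑-refl)) (⟶-refl _)

  enumerated : ∀ {P : A → Set} (f : Fin m → A) → (∀ p → P (f p)) →
               (∀ {p q} → p F.< q → ¬ f p ≈ f q) → (∀ x → P x → ∃ λ p → x ≈ f p) →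
               HasExactly _≈_ _≤_ m P
  enumerated f Pf distinct complete = List.tabulate f
    , length-tabulate f
    , All.tabulate⁺ Pf
    , AllPairs.tabulate⁺-< distinct
    , λ x Px → let p , x≈ = complete x Px in Any.tabulate⁺ p x≈

  isTrimLattice : IsTrimLattice _≈_ _≤_
  isTrimLattice = _∨_ , _∧_ , isLattice , finiteCarrier , m , leftModularMaximalChain
    , enumerated J J-joinIrreducible J-distinct joinIrreducible⇒J
    , enumerated M M-meetIrreducible M-distinct meetIrreducible⇒M

-- Auxiliary facts on lists and on maps of finite sets

AllPairs-lookup : ∀ {A : Set} {R : Rel A 0ℓ} {xs} → AllPairs R xs →
                  ∀ {i j} → i F.< j → R (List.lookup xs i) (List.lookup xs j)
AllPairs-lookup (Rx ∷ _) {zero}  {suc j} _   = All.lookup Rx (∈-lookup j)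
AllPairs-lookup (_ ∷ Rs) {suc i} {suc j} i<j = AllPairs-lookup Rs (ℕ.s≤s⁻¹ i<j)

injective⇒surjective : ∀ {n} {f : Fin n → Fin n} → Injective _≡_ _≡_ f → ∀ y → ∃ λ x → f x ≡ y
injective⇒surjective {suc n} {f} f-inj y with F.any? (λ x → f x F.≟ y)
... | yes hit = hit
... | no miss = contradiction
  (λ {i} {j} → f-inj ∘ F.punchOut-injective (avoids i) (avoids j)) (F.<⇒notInjective ℕ.≤-refl)
  where
  avoids : ∀ x → y ≢ f x
  avoids x y≡fx = miss (x , sym y≡fx)

≡-or-< : ∀ {n} {u v : Fin n} → u F.≤ v → u ≡ v ⊎ u F.< v
≡-or-< u≤v = Sum.swap (Sum.map₂ F.toℕ-injective (ℕ.m≤n⇒m<n∨m≡n u≤v))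

monotone⇒inflationary : ∀ {n} {f : Fin n → Fin n} →
  (∀ {i j} → i F.< j → f i F.< f j) → ∀ i → i F.≤ f i
-- The pivot is some j ≤ i with i ≤ f j; monotonicity carries this bound over to f i.
monotone⇒inflationary {f = f} mono i with F.injective⇒existsPivot inj i
  where
  inj : Injective _≡_ _≡_ f
  inj {i} {j} fi≡fj with F.<-cmp i j
  ... | tri< i<j _ _ = contradiction fi≡fj (F.<⇒≢ (mono i<j))
  ... | tri≈ _ i≡j _ = i≡j
  ... | tri> _ _ j<i = contradiction (sym fi≡fj) (F.<⇒≢ (mono j<i))
... | j , j≤i , i≤fj with ℕ.m≤n⇒m<n∨m≡n j≤i
...   | inj₁ j<i = ℕ.≤-trans i≤fj (ℕ.<⇒≤ (mono j<i))
...   | inj₂ j≡i = subst (λ j → i F.≤ f j) (F.toℕ-injective j≡i) i≤fj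

-- Permutations from strict total orders

module Ranking {n} {_≺_ : Rel (Fin n) 0ℓ} (_≺?_ : B.Decidable _≺_)
  (≺-irrefl : ∀ {u} → ¬ u ≺ u) (≺-trans : Transitive _≺_)
  (≺-connex : ∀ {u v} → u ≢ v → u ≺ v ⊎ v ≺ u) where

  down : Fin n → Subset n
  down v = ⟪ _≺? v ⟫

  -- The letters before v omit v itself, so there are fewer than n of them and their number is a
  -- valid position.
  rank : Fin n → Fin n
  rank v = fromℕ< (subst (∣ down v ∣ ℕ.<_) (∣⊤∣≡n n)
    (p⊂q⇒∣p∣<∣q∣ ((λ _ → ∈⊤) , v , ∈⊤ , ≺-irrefl ∘ ∈⟪⟫⁻ (_≺? v))))

  rank-mono : ∀ {u v} → u ≺ v → rank u F.< rank v
  rank-mono {u} {v} u≺v = subst₂ ℕ._<_ (sym (F.toℕ-fromℕ< _)) (sym (F.toℕ-fromℕ< _))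
    (p⊂q⇒∣p∣<∣q∣ ( (λ w∈ → ∈⟪⟫⁺ (_≺? v) (≺-trans (∈⟪⟫⁻ (_≺? u) w∈) u≺v))
                 , u , ∈⟪⟫⁺ (_≺? v) u≺v , ≺-irrefl ∘ ∈⟪⟫⁻ (_≺? u)))

  rank-reflects : ∀ {u v} → rank u F.< rank v → u ≺ v
  rank-reflects {u} {v} ru<rv with u F.≟ v
  ... | yes refl = contradiction ru<rv (ℕ.<-irrefl refl)
  ... | no u≢v with ≺-connex u≢v
  ...   | inj₁ u≺v = u≺v
  ...   | inj₂ v≺u = contradiction ru<rv (ℕ.<-asym (rank-mono v≺u))

  rank-injective : Injective _≡_ _≡_ rank
  rank-injective {u} {v} eq with u F.≟ v
  ... | yes u≡v = u≡v
  ... | no u≢v = contradiction eq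
    ([ F.<⇒≢ ∘ rank-mono , (λ v≺u → F.<⇒≢ (rank-mono v≺u) ∘ sym) ]′ (≺-connex u≢v))

  letterAt : ∀ p → ∃ λ v → rank v ≡ p
  letterAt = injective⇒surjective rank-injective

  perm : Perm n
  perm = proj₁ ∘ letterAt , λ {p} {q} eq →
    trans (sym (proj₂ (letterAt p))) (trans (cong rank eq) (proj₂ (letterAt q)))

  precedes⁺ : ∀ {u v} → u ≺ v → Precedes perm u v
  precedes⁺ {u} {v} u≺v = rank u , rank v , rank-mono u≺v
    , rank-injective (proj₂ (letterAt (rank u))) , rank-injective (proj₂ (letterAt (rank v)))

  precedes⁻ : ∀ {u v} → Precedes perm u v → u ≺ v
  precedes⁻ (p , q , p<q , refl , refl) =
    rank-reflects (subst₂ F._<_ (sym (proj₂ (letterAt p))) (sym (proj₂ (letterAt q))) p<q)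

-- Precedence of letters and antisymmetry of weak order

module _ {n} (π : Perm n) where

  position : Fin n → Fin n
  position v = proj₁ (injective⇒surjective (proj₂ π) v)

  word-position : ∀ v → word π (position v) ≡ v
  word-position v = proj₂ (injective⇒surjective (proj₂ π) v)

  position-word : ∀ p → position (word π p) ≡ p
  position-word p = proj₂ π (word-position (word π p))

  precedes-position⁺ : ∀ {u v} → position u F.< position v → Precedes π u v
  precedes-position⁺ u<v = position _ , position _ , u<v , word-position _ , word-position _

  precedes-position⁻ : ∀ {u v} → Precedes π u v → position u F.< position v
  precedes-position⁻ (p , q , p<q , refl , refl) =
    subst₂ F._<_ (sym (position-word p)) (sym (position-word q)) p<q

  precedes-trans : Transitive (Precedes π)
  precedes-trans uv vw =
    precedes-position⁺ (F.<-trans (precedes-position⁻ uv) (precedes-position⁻ vw))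

  precedes-asym : ∀ {u v} → Precedes π u v → ¬ Precedes π v u
  precedes-asym uv vu = F.<-asym (precedes-position⁻ uv) (precedes-position⁻ vu)

  precedes-connex : ∀ {u v} → u ≢ v → Precedes π u v ⊎ Precedes π v u
  precedes-connex {u} {v} u≢v with F.<-cmp (position u) (position v)
  ... | tri< u<v _ _ = inj₁ (precedes-position⁺ u<v)
  ... | tri≈ _ eq _  = contradiction
    (trans (sym (word-position u)) (trans (cong (word π) eq) (word-position v))) u≢v
  ... | tri> _ _ v<u = inj₂ (precedes-position⁺ v<u)

  precedes? : B.Decidable (Precedes π)
  precedes? u v = map′ precedes-position⁺ precedes-position⁻ (position u F.<? position v)

-- Permutations with the same inversions order every pair of letters alike, so passing from
-- positions in π to positions in σ is strictly increasing.
≤w-antisym⇒inflationary : ∀ {n} (π σ : Perm n) → π ≤w σ → σ ≤w π →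
                          ∀ p → p F.≤ position σ (word π p)
≤w-antisym⇒inflationary π σ π≤σ σ≤π = monotone⇒inflationary λ p<q →
  precedes-position⁻ σ (transfer (_ , _ , p<q , refl , refl))
  where
  transfer : ∀ {u v} → Precedes π u v → Precedes σ u v
  transfer {u} {v} uv with F.<-cmp u v
  ... | tri> _ _ v<u = π≤σ v u v<u uv
  ... | tri≈ _ refl _ = contradiction uv (precedes-asym π uv)
  ... | tri< u<v u≢v _ with precedes-connex σ u≢v
  ...   | inj₁ uv′ = uv′
  ...   | inj₂ vu = contradiction (σ≤π u v u<v vu) (precedes-asym π uv)

-- The change of positions and its inverse are both inflationary, so every position is fixed.
≤w-antisym : ∀ {n} (π σ : Perm n) → π ≤w σ → σ ≤w π → π ≈w σ
≤w-antisym π σ π≤σ σ≤π p = trans (sym (word-position σ (word π p))) (cong (word σ) fixed)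
  where
  fixed : position σ (word π p) ≡ p
  fixed = F.≤-antisym
    (subst (position σ (word π p) F.≤_)
      (trans (cong (position π) (word-position σ (word π p))) (position-word π p))
      (≤w-antisym⇒inflationary σ π σ≤π π≤σ (position σ (word π p))))
    (≤w-antisym⇒inflationary π σ π≤σ σ≤π p)

≈w⇒≤w : ∀ {n} (π σ : Perm n) → π ≈w σ → π ≤w σ
≈w⇒≤w π σ π≈σ a b _ (p , q , p<q , refl , refl) = p , q , p<q , sym (π≈σ p) , sym (π≈σ q)

-- Cambrian permutations as closed relations

module _ {k : ℕ} (o : Orientation k) where

  private
    n : ℕ
    n = suc (suc k)

    U D : Fin n → Set
    U = InU o
    D = InD o

  U? : ∀ v → Dec (U v)
  U? v = F.any? λ j → (toℕ v ℕ.≟ suc (toℕ j)) ×-dec (o j Bool.≟ false)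

  D? : ∀ v → Dec (D v)
  D? v = F.any? λ j → (toℕ v ℕ.≟ suc (toℕ j)) ×-dec (o j Bool.≟ true)

  U-D-disjoint : ∀ {v} → U v → ¬ D v
  U-D-disjoint (i , v≡i , oi) (j , v≡j , oj)
    with F.toℕ-injective (ℕ.suc-injective (trans (sym v≡i) v≡j))
  ... | refl with trans (sym oi) oj
  ...   | ()

  -- Only the smallest and the largest letter carry no orientation, and neither lies strictly
  -- between two others.
  interior : ∀ {a b c : Fin n} → a F.< b → b F.< c → U b ⊎ D b
  interior {b = zero}  () _
  interior {b = suc b} {c} _ b<c = by-orientation (o j) refl
    where
    b<k : toℕ b ℕ.< k
    b<k = ℕ.s≤s⁻¹ (ℕ.s≤s⁻¹ (ℕ.≤-trans (s≤s b<c) (F.toℕ<n c)))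
    j : Fin k
    j = fromℕ< b<k
    b≡j : suc (toℕ b) ≡ suc (toℕ j)
    b≡j = cong suc (sym (F.toℕ-fromℕ< b<k))
    by-orientation : ∀ t → o j ≡ t → U (suc b) ⊎ D (suc b)
    by-orientation false oj = inj₁ (j , b≡j , oj)
    by-orientation true  oj = inj₂ (j , b≡j , oj)

  -- With `R a c` read as "c precedes a", `U-closed` forbids the pattern bca with b in U, and
  -- `D-closed` the pattern cab with b in D.
  record Closed (R : Rel (Fin n) 0ℓ) : Set where
    field
      T-closed : ∀ {a b c} → a F.< b → b F.< c → R a b → R b c → R a c
      U-closed : ∀ {a b c} → a F.< b → b F.< c → U b → R a c → R b c
      D-closed : ∀ {a b c} → a F.< b → b F.< c → D b → R a c → R a b

    -- This is transitivity of the non-inversions, which a set of pairs needs besides `T-closed` in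
    -- order to be an inversion set.
    cotransitive : ∀ {a b c} → a F.< b → b F.< c → R a c → R a b ⊎ R b c
    cotransitive a<b b<c Rac with interior a<b b<c
    ... | inj₁ Ub = inj₂ (U-closed a<b b<c Ub Rac)
    ... | inj₂ Db = inj₁ (D-closed a<b b<c Db Rac)

  Inverted : CambrianPerm o → Rel (Fin n) 0ℓ
  Inverted x a c = Precedes (proj₁ x) c a

  inverted-closed : ∀ x → Closed (Inverted x)
  inverted-closed (π , no-231 , no-312) = record
    { T-closed = λ _ _ ba cb → precedes-trans π cb ba
    ; U-closed = λ {a} {b} {c} a<b b<c Ub ca →
        [ (λ bc → contradiction (231-at a<b b<c Ub bc ca) no-231) , id ]′
          (precedes-connex π (F.<⇒≢ b<c))
    ; D-closed = λ {a} {b} {c} a<b b<c Db ca →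
        [ (λ ab → contradiction (312-at a<b b<c Db ca ab) no-312) , id ]′
          (precedes-connex π (F.<⇒≢ a<b))
    }
    where
    wp : ∀ v → word π (position π v) ≡ v
    wp = word-position π
    231-at : ∀ {a b c} → a F.< b → b F.< c → U b →
             Precedes π b c → Precedes π c a → Contains231 o π
    231-at {a} {b} {c} a<b b<c Ub bc ca = position π b , position π c , position π a
      , precedes-position⁻ π bc , precedes-position⁻ π ca
      , subst₂ F._<_ (sym (wp a)) (sym (wp b)) a<b
      , subst₂ F._<_ (sym (wp b)) (sym (wp c)) b<c , subst U (sym (wp b)) Ub
    312-at : ∀ {a b c} → a F.< b → b F.< c → D b →
             Precedes π c a → Precedes π a b → Contains312 o π
    312-at {a} {b} {c} a<b b<c Db ca ab = position π c , position π a , position π b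
      , precedes-position⁻ π ca , precedes-position⁻ π ab
      , subst₂ F._<_ (sym (wp a)) (sym (wp b)) a<b
      , subst₂ F._<_ (sym (wp b)) (sym (wp c)) b<c , subst D (sym (wp b)) Db

  -- From closed relations back to permutations

  module Realisation {R : Rel (Fin n) 0ℓ} (R? : B.Decidable R) (closed : Closed R) where

    open Closed closed

    _≺_ : Rel (Fin n) 0ℓ
    u ≺ v = (u F.< v × ¬ R u v) ⊎ (v F.< u × R v u)

    _≺?_ : B.Decidable _≺_
    u ≺? v = (u F.<? v ×-dec ¬? (R? u v)) ⊎-dec (v F.<? u ×-dec R? v u)

    ≺-irrefl : ∀ {u} → ¬ u ≺ u
    ≺-irrefl = [ F.<-irrefl refl ∘ proj₁ , F.<-irrefl refl ∘ proj₁ ]′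

    ≺-connex : ∀ {u v} → u ≢ v → u ≺ v ⊎ v ≺ u
    ≺-connex {u} {v} u≢v with F.<-cmp u v
    ... | tri≈ _ u≡v _ = contradiction u≡v u≢v
    ... | tri< u<v _ _ with R? u v
    ...   | yes r = inj₂ (inj₂ (u<v , r))
    ...   | no ¬r = inj₁ (inj₁ (u<v , ¬r))
    ≺-connex {u} {v} u≢v | tri> _ _ v<u with R? v u
    ...   | yes r = inj₁ (inj₂ (v<u , r))
    ...   | no ¬r = inj₂ (inj₁ (v<u , ¬r))

    -- Increasing triples use `cotransitive` and decreasing ones `T-closed`; a mixed triple reduces
    -- to one of these once u and w are compared.
    ≺-trans : Transitive _≺_
    ≺-trans (inj₁ (u<v , ¬uv)) (inj₁ (v<w , ¬vw)) =
      inj₁ (F.<-trans u<v v<w , [ ¬uv , ¬vw ]′ ∘ cotransitive u<v v<w)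
    ≺-trans (inj₂ (v<u , vu)) (inj₂ (w<v , wv)) =
      inj₂ (F.<-trans w<v v<u , T-closed w<v v<u wv vu)
    ≺-trans {u} {v} {w} (inj₁ (u<v , ¬uv)) (inj₂ (w<v , wv)) with F.<-cmp u w
    ... | tri< u<w _ _  = inj₁ (u<w , λ uw → ¬uv (T-closed u<w w<v uw wv))
    ... | tri≈ _ refl _ = contradiction wv ¬uv
    ... | tri> _ _ w<u  = inj₂ (w<u ,
      [ id , (λ uv → contradiction uv ¬uv) ]′ (cotransitive w<u u<v wv))
    ≺-trans {u} {v} {w} (inj₂ (v<u , vu)) (inj₁ (v<w , ¬vw)) with F.<-cmp u w
    ... | tri< u<w _ _  = inj₁ (u<w , λ uw → ¬vw (T-closed v<u u<w vu uw))
    ... | tri≈ _ refl _ = contradiction vu ¬vw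
    ... | tri> _ _ w<u  = inj₂ (w<u ,
      [ (λ vw → contradiction vw ¬vw) , id ]′ (cotransitive v<w w<u vu))

    open Ranking _≺?_ ≺-irrefl ≺-trans ≺-connex using (perm; precedes⁺; precedes⁻)

    inversion⁺ : ∀ {a c} → a F.< c → R a c → Precedes perm c a
    inversion⁺ a<c r = precedes⁺ (inj₂ (a<c , r))

    inversion⁻ : ∀ {a c} → a F.< c → Precedes perm c a → R a c
    inversion⁻ a<c ca with precedes⁻ ca
    ... | inj₁ (c<a , _) = contradiction a<c (F.<-asym c<a)
    ... | inj₂ (_ , r)   = r

    realise : CambrianPerm o
    realise = perm
      , (λ (p , q , r , p<q , q<r , a<b , b<c , Ub) →
          precedes-asym perm (p , q , p<q , refl , refl)
            (inversion⁺ b<c (U-closed a<b b<c Ub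
              (inversion⁻ (F.<-trans a<b b<c) (q , r , q<r , refl , refl)))))
      , (λ (p , q , r , p<q , q<r , a<b , b<c , Db) →
          precedes-asym perm (q , r , q<r , refl , refl)
            (inversion⁺ a<b (D-closed a<b b<c Db
              (inversion⁻ (F.<-trans a<b b<c) (p , q , p<q , refl , refl)))))

  -- The sets J and K and the relation between them

  module _ (L R : Fin n → Set) where

    -- The condition u < v is left out here and imposed in `Hits`.
    Span : Rel (Fin n × Fin n) 0ℓ
    Span (u , v) (a , c) = (a F.≤ u × (u ≡ a ⊎ L u)) × (v F.≤ c × (v ≡ c ⊎ R v))

    span? : (∀ v → Dec (L v)) → (∀ v → Dec (R v)) → B.Decidable Span
    span? L? R? (u , v) (a , c) =
      (a F.≤? u ×-dec (u F.≟ a ⊎-dec L? u)) ×-dec (v F.≤? c ×-dec (v F.≟ c ⊎-dec R? v))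

    span-refl : ∀ {p} → Span p p
    span-refl = (F.≤-refl , inj₁ refl) , (F.≤-refl , inj₁ refl)

    span-trans : Transitive Span
    span-trans ((b≤a , a-end) , (c≤d , c-end)) ((e≤b , b-end) , (d≤f , d-end)) =
        (F.≤-trans e≤b b≤a , [ (λ { refl → b-end }) , inj₂ ]′ a-end)
      , (F.≤-trans c≤d d≤f , [ (λ { refl → d-end }) , inj₂ ]′ c-end)

  InJ InK : Rel (Fin n × Fin n) 0ℓ
  InJ = Span U D
  InK = Span D U

  inJ? : B.Decidable InJ
  inJ? = span? U D U? D?

  inK? : B.Decidable InK
  inK? = span? D U D? U?

  interior-end : ∀ {P : Set} {u a : Fin n} → u ≡ a ⊎ P → u ≢ a → P
  interior-end (inj₁ u≡a) u≢a = contradiction u≡a u≢a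
  interior-end (inj₂ Pu)  _   = Pu

  -- An end of q that is not the corresponding end of p would lie in both U and D.
  J∩K : ∀ {p q} → InJ q p → InK q p → q ≡ p
  J∩K ((_ , u∈J) , (_ , v∈J)) ((_ , u∈K) , (_ , v∈K)) =
    cong₂ _,_ (endpoint u∈J u∈K) (endpoint v∈K v∈J)
    where
    endpoint : ∀ {u a} → u ≡ a ⊎ U u → u ≡ a ⊎ D u → u ≡ a
    endpoint (inj₁ eq) _         = eq
    endpoint (inj₂ _)  (inj₁ eq) = eq
    endpoint (inj₂ Uu) (inj₂ Du) = contradiction Du (U-D-disjoint Uu)

  Hits : Rel (Fin n × Fin n) 0ℓ
  Hits p q = ∃₂ λ u v → u F.< v × InJ (u , v) p × InK (u , v) q

  hits? : B.Decidable Hits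
  hits? p q = F.any? λ u → F.any? λ v → u F.<? v ×-dec inJ? (u , v) p ×-dec inK? (u , v) q

  hits-refl : ∀ {a c} → a F.< c → Hits (a , c) (a , c)
  hits-refl a<c = _ , _ , a<c , span-refl U D , span-refl D U

  hits-mono : ∀ {p q r} → InJ q p → Hits q r → Hits p r
  hits-mono q∈Jp (u , v , u<v , ∈J , ∈K) = u , v , u<v , span-trans U D ∈J q∈Jp , ∈K

  inJ-closed : ∀ a c → Closed (λ u v → InJ (u , v) (a , c))
  inJ-closed a c = record
    -- J never contains both ab and bc: as a right end b is the outer right end or in D, as a left
    -- end it is the outer left end or in U, and no combination is possible.
    { T-closed = λ { _ b<c (_ , (_ , inj₁ refl)) (_ , (c≤b , _)) →
                       contradiction c≤b (ℕ.<⇒≱ b<c)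
                   ; a<b _ ((b≤a , _) , _) ((_ , inj₁ refl) , _) →
                       contradiction b≤a (ℕ.<⇒≱ a<b)
                   ; _ _ (_ , (_ , inj₂ Db)) ((_ , inj₂ Ub) , _) →
                       contradiction Db (U-D-disjoint Ub) }
    ; U-closed = λ a<b _ Ub ((a≤ , _) , right) → (F.≤-trans a≤ (ℕ.<⇒≤ a<b) , inj₂ Ub) , right
    ; D-closed = λ _ b<c Db (left , (≤c , _)) → left , (F.≤-trans (ℕ.<⇒≤ b<c) ≤c , inj₂ Db)
    }

  missing-closed : ∀ q → Closed (λ a c → ¬ Hits (a , c) q)
  missing-closed q = record
    { T-closed = T
    ; U-closed = λ a<b b<c Ub ¬hit → ¬hit ∘
        hits-mono ((ℕ.<⇒≤ a<b , inj₂ Ub) , (F.≤-refl , inj₁ refl))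
    ; D-closed = λ a<b b<c Db ¬hit → ¬hit ∘
        hits-mono ((F.≤-refl , inj₁ refl) , (ℕ.<⇒≤ b<c , inj₂ Db))
    }
    where
    T : ∀ {a b c} → a F.< b → b F.< c → ¬ Hits (a , b) q → ¬ Hits (b , c) q → ¬ Hits (a , c) q
    T {a} {b} {c} a<b b<c ¬ab ¬bc
      (u , v , u<v , ((a≤u , u-end) , (v≤c , v-end)) , ((q≤u , u-end′) , (v≤q , v-end′)))
      with v F.≤? b | b F.≤? u
    ... | yes v≤b | _ = ¬ab (u , v , u<v
      , ((a≤u , u-end) , (v≤b , [ (λ { refl → contradiction v≤b (ℕ.<⇒≱ b<c) }) , inj₂ ]′ v-end))
      , ((q≤u , u-end′) , (v≤q , v-end′)))
    ... | no _ | yes b≤u = ¬bc (u , v , u<v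
      , ((b≤u , [ (λ { refl → contradiction b≤u (ℕ.<⇒≱ a<b) }) , inj₂ ]′ u-end) , (v≤c , v-end))
      , ((q≤u , u-end′) , (v≤q , v-end′)))
    -- Here u < b < v, so (u,v) is cut at b. The set K admits right ends in U and left ends in D, so
    -- it keeps (u,b) in the first case and (b,v) in the second.
    ... | no v≰b | no b≰u with interior (ℕ.≰⇒> b≰u) (ℕ.≰⇒> v≰b)
    ...   | inj₁ Ub = ¬ab (u , b , ℕ.≰⇒> b≰u
      , ((a≤u , u-end) , (F.≤-refl , inj₁ refl))
      , ((q≤u , u-end′) , (F.≤-trans (ℕ.≰⇒≥ v≰b) v≤q , inj₂ Ub)))
    ...   | inj₂ Db = ¬bc (b , v , ℕ.≰⇒> v≰b
      , ((F.≤-refl , inj₁ refl) , (v≤c , v-end))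
      , ((F.≤-trans q≤u (ℕ.≰⇒≥ b≰u) , inj₂ Db) , (v≤q , v-end′)))

  -- Separation for closed relations

  module _ {R : Rel (Fin n) 0ℓ} (closed : Closed R) where

    open Closed closed

    inJ-down : ∀ {a c u v} → u F.< v → InJ (u , v) (a , c) → R a c → R u v
    inJ-down {a} {c} {u} {v} u<v ((a≤u , u-end) , (v≤c , v-end)) = right v-end ∘ left u-end
      where
      left : u ≡ a ⊎ U u → R a c → R u c
      left (inj₁ refl) r = r
      left (inj₂ Uu)   r with ≡-or-< a≤u
      ... | inj₁ refl = r
      ... | inj₂ a<u  = U-closed a<u (ℕ.≤-trans u<v v≤c) Uu r
      right : v ≡ c ⊎ D v → R u c → R u v
      right (inj₁ refl) r = r
      right (inj₂ Dv)   r with ≡-or-< v≤c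
      ... | inj₁ refl = r
      ... | inj₂ v<c  = D-closed u<v v<c Dv r

    -- The outer steps from a to u and from v to c may be empty, hence the conditional hypotheses.
    extend : ∀ {a u v c} → u F.< v → a F.≤ u → v F.≤ c →
             (u ≢ a → R a u) → (v ≢ c → R v c) → R u v → R a c
    extend {a} {u} {v} {c} u<v a≤u v≤c Rau Rvc Ruv with u F.≟ a | v F.≟ c
    ... | yes refl | yes refl = Ruv
    ... | yes refl | no v≢c   = T-closed u<v (F.≤∧≢⇒< v≤c v≢c) Ruv (Rvc v≢c)
    ... | no u≢a   | yes refl = T-closed (F.≤∧≢⇒< a≤u (u≢a ∘ sym)) u<v (Rau u≢a) Ruv
    ... | no u≢a   | no v≢c   = T-closed (F.≤∧≢⇒< a≤u (u≢a ∘ sym)) (ℕ.≤-trans u<v v≤c) (Rau u≢a)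
                                  (T-closed u<v (F.≤∧≢⇒< v≤c v≢c) Ruv (Rvc v≢c))

    Separated : Rel (Fin n) 0ℓ
    Separated a c = ∃₂ λ s t → s F.< t × InJ (s , t) (a , c)
                             × (∀ {u v} → u F.< v → InK (u , v) (s , t) → ¬ R u v)

    -- Induction on a bound d for c - a. If K(a,c) meets R in (u,v), then by transitivity R lacks
    -- (a,u) with u in D, or (v,c) with v in U. Either pair is in J(a,c) and shorter, and J is
    -- transitive.
    separating-pair : B.Decidable R → ∀ {a c} → a F.< c → ¬ R a c → Separated a c
    separating-pair R? {a} {c} = search (toℕ c) (ℕ.m≤n+m (toℕ c) (toℕ a))
      where
      search : ∀ {a c} d → toℕ c ℕ.≤ toℕ a ℕ.+ d → a F.< c → ¬ R a c → Separated a c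
      search {a} {c} ℕ.zero c≤a a<c _ =
        contradiction (subst (toℕ c ℕ.≤_) (ℕ.+-identityʳ (toℕ a)) c≤a) (ℕ.<⇒≱ a<c)
      search {a} {c} (suc d) c≤a+d a<c ¬Rac
        with F.any? (λ u → F.any? λ v → u F.<? v ×-dec inK? (u , v) (a , c) ×-dec R? u v)
      ... | no none = a , c , a<c , span-refl U D , λ u<v ∈K Ruv → none (_ , _ , u<v , ∈K , Ruv)
      ... | yes (u , v , u<v , ((a≤u , u-end) , (v≤c , v-end)) , Ruv) = shrink
        where
        shrink-to : ∀ {a′ c′} → toℕ c′ ℕ.≤ toℕ a′ ℕ.+ d → InJ (a′ , c′) (a , c) →
                    a′ F.< c′ → ¬ R a′ c′ → Separated a c
        shrink-to bound ∈J a′<c′ ¬R =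
          let s , t , s<t , ∈J′ , apart = search d bound a′<c′ ¬R
          in  s , t , s<t , span-trans U D ∈J′ ∈J , apart
        c≤1+a+d : toℕ c ℕ.≤ suc (toℕ a ℕ.+ d)
        c≤1+a+d = subst (toℕ c ℕ.≤_) (ℕ.+-suc (toℕ a) d) c≤a+d
        u<c : u F.< c
        u<c = ℕ.≤-trans u<v v≤c
        a<v : a F.< v
        a<v = ℕ.≤-<-trans a≤u u<v
        shrink : Separated a c
        shrink with (¬? (u F.≟ a)) →-dec R? a u | (¬? (v F.≟ c)) →-dec R? v c
        ... | yes Rau | yes Rvc = contradiction (extend u<v a≤u v≤c Rau Rvc Ruv) ¬Rac
        ... | no ¬Rau | _ = shrink-to
          (ℕ.s≤s⁻¹ (ℕ.≤-trans u<c c≤1+a+d))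
          ((F.≤-refl , inj₁ refl) , (ℕ.<⇒≤ u<c , inj₂ (interior-end u-end u≢a)))
          (F.≤∧≢⇒< a≤u (u≢a ∘ sym)) (¬Rau ∘ const)
          where
          u≢a : u ≢ a
          u≢a u≡a = ¬Rau (λ u≢a → contradiction u≡a u≢a)
        ... | yes _ | no ¬Rvc = shrink-to
          (ℕ.≤-trans c≤1+a+d (ℕ.+-monoˡ-≤ d a<v))
          ((ℕ.<⇒≤ a<v , inj₂ (interior-end v-end v≢c)) , (F.≤-refl , inj₁ refl))
          (F.≤∧≢⇒< v≤c v≢c) (¬Rvc ∘ const)
          where
          v≢c : v ≢ c
          v≢c v≡c = ¬Rvc (λ v≢c → contradiction v≡c v≢c)

    -- The common pair (u,v) is in R because J(p) is. The outer pieces (a,u) and (v,c), where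
    -- nonempty, do not hit (a,c), so they are in R too, and the three compose to (a,c).
    hits-target : ∀ {p a c} → (∀ {u v} → u F.< v → ¬ Hits (u , v) (a , c) → R u v) →
                  Hits p (a , c) → R (proj₁ p) (proj₂ p) → R a c
    hits-target {p} {a} {c} R-above (u , v , u<v , ∈J , ((a≤u , u-end) , (v≤c , v-end))) Rp =
      extend u<v a≤u v≤c
        (λ u≢a → R-above (F.≤∧≢⇒< a≤u (u≢a ∘ sym)) (left-clear (interior-end u-end u≢a)))
        (λ v≢c → R-above (F.≤∧≢⇒< v≤c v≢c) (right-clear (interior-end v-end v≢c)))
        (inJ-down u<v ∈J Rp)
      where
      left-clear : D u → ¬ Hits (a , u) (a , c)
      -- The right end t of a common pair is at most u < c, so K puts it in U, while J puts it in D.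
      left-clear Du (s , t , _ , (_ , (t≤u , t-end)) , (_ , (_ , t-end′))) =
        U-D-disjoint (interior-end t-end′ (λ { refl → ℕ.<⇒≱ u<v (F.≤-trans v≤c t≤u) }))
                     ([ (λ { refl → Du }) , id ]′ t-end)
      right-clear : U v → ¬ Hits (v , c) (a , c)
      right-clear Uv (s , t , _ , ((v≤s , s-end) , _) , ((_ , s-end′) , _)) =
        U-D-disjoint ([ (λ { refl → Uv }) , id ]′ s-end)
                     (interior-end s-end′ (λ { refl → ℕ.<⇒≱ u<v (F.≤-trans v≤s a≤u) }))

  -- A linear extension of the hitting relation

  -- Hits p q forces leftKey and rightKey to be weakly smaller on q than on p: the left end of the
  -- intersecting interval is the larger of the two left ends, which lies in D if it comes from p
  -- and in U if it comes from q; dually for right ends.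
  leftKey rightKey : Fin n → ℕ
  leftKey v with U? v
  ... | yes _ = n ℕ.∸ toℕ v
  ... | no  _ = n ℕ.+ toℕ v
  rightKey v with U? v
  ... | yes _ = n ℕ.+ (n ℕ.∸ toℕ v)
  ... | no  _ = toℕ v

  key : Fin n × Fin n → ℕ
  key (a , c) = leftKey a ℕ.+ rightKey c

  -- Left keys list U in decreasing order, then the other letters in increasing order; right keys
  -- list the letters outside U increasingly, then U decreasingly. The bounds here compare a letter
  -- of known type with an arbitrary one.
  leftKey-≥ : ∀ v → n ℕ.∸ toℕ v ℕ.≤ leftKey v
  leftKey-≥ v with U? v
  ... | yes _ = ℕ.≤-refl
  ... | no  _ = ℕ.≤-trans (ℕ.m∸n≤m n (toℕ v)) (ℕ.m≤m+n n (toℕ v))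

  leftKey-≤ : ∀ v → leftKey v ℕ.≤ n ℕ.+ toℕ v
  leftKey-≤ v with U? v
  ... | yes _ = ℕ.≤-trans (ℕ.m∸n≤m n (toℕ v)) (ℕ.m≤m+n n (toℕ v))
  ... | no  _ = ℕ.≤-refl

  leftKey-U : ∀ {v} → U v → leftKey v ≡ n ℕ.∸ toℕ v
  leftKey-U {v} Uv with U? v
  ... | yes _  = refl
  ... | no ¬Uv = contradiction Uv ¬Uv

  leftKey-D : ∀ {v} → D v → leftKey v ≡ n ℕ.+ toℕ v
  leftKey-D {v} Dv with U? v
  ... | yes Uv = contradiction Dv (U-D-disjoint Uv)
  ... | no _   = refl

  rightKey-≥ : ∀ v → toℕ v ℕ.≤ rightKey v
  rightKey-≥ v with U? v
  ... | yes _ = ℕ.≤-trans (ℕ.<⇒≤ (F.toℕ<n v)) (ℕ.m≤m+n n (n ℕ.∸ toℕ v))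
  ... | no  _ = ℕ.≤-refl

  rightKey-≤ : ∀ v → rightKey v ℕ.≤ n ℕ.+ (n ℕ.∸ toℕ v)
  rightKey-≤ v with U? v
  ... | yes _ = ℕ.≤-refl
  ... | no  _ = ℕ.≤-trans (ℕ.<⇒≤ (F.toℕ<n v)) (ℕ.m≤m+n n (n ℕ.∸ toℕ v))

  rightKey-U : ∀ {v} → U v → rightKey v ≡ n ℕ.+ (n ℕ.∸ toℕ v)
  rightKey-U {v} Uv with U? v
  ... | yes _  = refl
  ... | no ¬Uv = contradiction Uv ¬Uv

  rightKey-D : ∀ {v} → D v → rightKey v ≡ toℕ v
  rightKey-D {v} Dv with U? v
  ... | yes Uv = contradiction Dv (U-D-disjoint Uv)
  ... | no _   = refl

  complement-< : ∀ {u v : Fin n} → u F.< v → n ℕ.∸ toℕ v ℕ.< n ℕ.∸ toℕ u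
  complement-< {u} {v} u<v = ℕ.∸-monoʳ-< u<v (ℕ.<⇒≤ (F.toℕ<n v))

  leftKey-decreases : ∀ {a x u} → x F.≤ u → u ≡ x ⊎ U u → a F.≤ u → u ≡ a ⊎ D u →
                      a ≡ x ⊎ leftKey a ℕ.< leftKey x
  leftKey-decreases _ (inj₂ Uu) _ (inj₂ Du) = contradiction Du (U-D-disjoint Uu)
  leftKey-decreases _ (inj₁ refl) _ (inj₁ refl) = inj₁ refl
  leftKey-decreases {a} {x} _ (inj₁ refl) a≤x (inj₂ Dx) = Sum.map₂
    (λ a<x → subst (leftKey a ℕ.<_) (sym (leftKey-D Dx))
      (ℕ.≤-<-trans (leftKey-≤ a) (ℕ.+-monoʳ-< n a<x)))
    (≡-or-< a≤x)
  leftKey-decreases {a} {x} x≤a (inj₂ Ua) _ (inj₁ refl) = Sum.map sym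
    (λ x<a → subst (ℕ._< leftKey x) (sym (leftKey-U Ua))
      (ℕ.<-≤-trans (complement-< x<a) (leftKey-≥ x)))
    (≡-or-< x≤a)

  rightKey-decreases : ∀ {c y v} → v F.≤ y → v ≡ y ⊎ D v → v F.≤ c → v ≡ c ⊎ U v →
                       c ≡ y ⊎ rightKey c ℕ.< rightKey y
  rightKey-decreases _ (inj₂ Dv) _ (inj₂ Uv) = contradiction Dv (U-D-disjoint Uv)
  rightKey-decreases _ (inj₁ refl) _ (inj₁ refl) = inj₁ refl
  rightKey-decreases {c} {y} _ (inj₁ refl) y≤c (inj₂ Uy) = Sum.map sym
    (λ y<c → subst (rightKey c ℕ.<_) (sym (rightKey-U Uy))
      (ℕ.≤-<-trans (rightKey-≤ c) (ℕ.+-monoʳ-< n (complement-< y<c))))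
    (≡-or-< y≤c)
  rightKey-decreases {c} {y} c≤y (inj₂ Dc) _ (inj₁ refl) = Sum.map₂
    (λ c<y → subst (ℕ._< rightKey y) (sym (rightKey-D Dc))
      (ℕ.<-≤-trans c<y (rightKey-≥ y)))
    (≡-or-< c≤y)

  hits-decreases : ∀ {p q} → Hits p q → q ≡ p ⊎ key q ℕ.< key p
  hits-decreases (_ , _ , _ , ((x≤u , u-end) , (v≤y , v-end)) , ((a≤u , u-end′) , (v≤c , v-end′)))
    with leftKey-decreases x≤u u-end a≤u u-end′ | rightKey-decreases v≤y v-end v≤c v-end′
  ... | inj₁ refl | inj₁ refl = inj₁ refl
  ... | inj₂ a<   | inj₂ c<   = inj₂ (ℕ.+-mono-< a< c<)
  ... | inj₁ refl | inj₂ c<   = inj₂ (ℕ.+-monoʳ-< _ c<)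
  ... | inj₂ a<   | inj₁ refl = inj₂ (ℕ.+-monoˡ-< _ a<)

  private
    keyOrder : DecTotalOrder 0ℓ 0ℓ 0ℓ
    keyOrder = On.decTotalOrder ℕ.≤-decTotalOrder key

    module KeySort = Sort keyOrder

    increasing? : (p : Fin n × Fin n) → Dec (proj₁ p F.< proj₂ p)
    increasing? (a , c) = a F.<? c

    unsorted : List (Fin n × Fin n)
    unsorted = filter increasing? (cartesianProduct (allFin n) (allFin n))

  pairs : List (Fin n × Fin n)
  pairs = KeySort.sort unsorted

  pairs-unique : Unique pairs
  pairs-unique = Permutation.Unique-resp-↭ (setoid _) (↭⇒↭ₛ (↭-sym (KeySort.sort-↭ unsorted)))
    (Unique.filter⁺ increasing? (Unique.cartesianProduct⁺ (Unique.allFin⁺ n) (Unique.allFin⁺ n)))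

  pair : Fin (length pairs) → Fin n × Fin n
  pair = List.lookup pairs

  left right : Fin (length pairs) → Fin n
  left  = proj₁ ∘ pair
  right = proj₂ ∘ pair

  left<right : ∀ i → left i F.< right i
  left<right i = proj₂ (∈-filter⁻ increasing? {xs = cartesianProduct (allFin n) (allFin n)}
    (∈-resp-↭ (KeySort.sort-↭ unsorted) (∈-lookup i)))

  pair-index : ∀ {a c} → a F.< c → ∃ λ i → (a , c) ≡ pair i
  pair-index {a} {c} a<c = Any.index ∈pairs , Any.lookup-index ∈pairs
    where
    ∈pairs : (a , c) ∈ˡ pairs
    ∈pairs = ∈-resp-↭ (↭-sym (KeySort.sort-↭ unsorted))
      (∈-filter⁺ increasing? (∈-cartesianProduct⁺ (∈-allFin a) (∈-allFin c)) a<c)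

  -- The list is sorted by increasing key, and an arrow between distinct pairs strictly lowers the
  -- key. Ties are harmless, since distinct pairs of equal key do not hit each other.
  hits-sorted : ∀ {i j} → i F.< j → ¬ Hits (pair i) (pair j)
  hits-sorted {i} {j} i<j hits with hits-decreases hits
  ... | inj₁ eq = AllPairs-lookup pairs-unique i<j (sym eq)
  ... | inj₂ lt = ℕ.<⇒≱ lt
    (lookup-mono-≤ (DecTotalOrder.totalOrder keyOrder) (KeySort.sort-↗ unsorted) (ℕ.<⇒≤ i<j))

  -- The presentation of the Cambrian lattice

  ≤B-isPartialOrder : IsPartialOrder (_≈B_ {k} {o}) (_≤B_ {k} {o})
  ≤B-isPartialOrder = record
    { isPreorder = record
      { isEquivalence = record
        { refl  = λ _ → refl
        ; sym   = λ eq p → sym (eq p)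
        ; trans = λ eq eq′ p → trans (eq p) (eq′ p)
        }
      ; reflexive = λ {x} {y} → ≈w⇒≤w (proj₁ x) (proj₁ y)
      ; trans = λ xy yz a b a<b → yz a b a<b ∘ xy a b a<b
      }
    ; antisym = λ {x} {y} → ≤w-antisym (proj₁ x) (proj₁ y)
    }

  MissesAll : Subset (length pairs) → Rel (Fin n) 0ℓ
  MissesAll Q a c = ∀ q → q ∈ Q → ¬ Hits (a , c) (pair q)

  missesAll? : ∀ Q → B.Decidable (MissesAll Q)
  missesAll? Q a c = F.all? λ q → (q ∈? Q) →-dec ¬? (hits? (a , c) (pair q))

  missesAll-closed : ∀ Q → Closed (MissesAll Q)
  missesAll-closed Q = record
    { T-closed = λ a<b b<c ab bc q q∈ → T-closed q a<b b<c (ab q q∈) (bc q q∈)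
    ; U-closed = λ a<b b<c Ub ac q q∈ → U-closed q a<b b<c Ub (ac q q∈)
    ; D-closed = λ a<b b<c Db ac q q∈ → D-closed q a<b b<c Db (ac q q∈)
    }
    where open module Missing q = Closed (missing-closed (pair q))

  private
    module InJ p = Realisation (λ u v → inJ? (u , v) (pair p)) (inJ-closed (left p) (right p))
    module Meet Q = Realisation (missesAll? Q) (missesAll-closed Q)

  presentation : Presentation (_≈B_ {k} {o}) (_≤B_ {k} {o})
  presentation = record
    { isPartialOrder = ≤B-isPartialOrder
    ; m          = length pairs
    ; _∋_        = λ x p → Inverted x (left p) (right p)
    ; _∋?_       = λ x p → precedes? (proj₁ x) (right p) (left p)
    ; ≤⇒∋        = λ {_} {_} {p} x≤y → x≤y _ _ (left<right p)
    ; ∋⇒≤        = λ {x} {y} x⊆y a c a<c → let i , eq = pair-index a<c in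
                     subst (λ p → Inverted x (proj₁ p) (proj₂ p) → Inverted y (proj₁ p) (proj₂ p))
                       (sym eq) (x⊆y i)
    ; _⊑_        = λ q p → InJ (pair q) (pair p)
    ; ∋-down     = λ {x} {p} {q} → inJ-down (inverted-closed x) (left<right q)
    ; J          = InJ.realise
    ; J∋⁺        = λ {p} {q} → InJ.inversion⁺ p (left<right q)
    ; J∋⁻        = λ {p} {q} → InJ.inversion⁻ p (left<right q)
    ; _⟶_        = λ p q → Hits (pair p) (pair q)
    ; _⟶?_       = λ p q → hits? (pair p) (pair q)
    ; ⟶-refl     = λ p → hits-refl (left<right p)
    ; ⟶-sorted   = hits-sorted
    ; ⋀          = Meet.realise
    ; ⋀∋⁺        = λ {Q} {p} → Meet.inversion⁺ Q (left<right p)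
    ; ⋀∋⁻        = λ {Q} {p} {q} ∋p → Meet.inversion⁻ Q (left<right p) ∋p q
    ; separation = λ {x} {p} → separation x p
    -- Since J(q) lies in J(p), the common pair is in J(p) and K(p), so it is p itself; hence p is
    -- in J(q).
    ; ⊑∧⟶⇒⊒      = λ { {p} {q} q⊑p (u , v , u<v , ∈Jq , ∈Kp) →
                       subst (λ r → InJ r (pair q)) (J∩K (span-trans U D ∈Jq q⊑p) ∈Kp) ∈Jq }
    ; ⟶-target   = λ {x} {p} {q} x-above → hits-target (inverted-closed x) λ u<v →
                     let i , eq = pair-index u<v in
                     subst (λ r → ¬ Hits r (pair q) → Inverted x (proj₁ r) (proj₂ r))
                       (sym eq) (x-above i)
    }
    where
    separation : ∀ x p → ¬ Inverted x (left p) (right p) →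
      ∃ λ q → InJ (pair q) (pair p)
            × Hits (pair p) (pair q)
            × (∀ r → Inverted x (left r) (right r) → ¬ Hits (pair r) (pair q))
    separation x p x∌p
      with s , t , s<t , ∈J , apart ← separating-pair (inverted-closed x)
             (λ a c → precedes? (proj₁ x) c a) (left<right p) x∌p
      with i , refl ← pair-index s<t
      = i , ∈J , hits-mono ∈J (hits-refl s<t)
      -- The common pair of J(r) and K would lie in x along with r, but `apart` keeps K disjoint
      -- from x.
      , λ { r x∋r (u , v , u<v , ∈Jr , ∈Ki) →
              apart u<v ∈Ki (inJ-down (inverted-closed x) u<v ∈Jr x∋r) }

theorem9 : (k : ℕ) (o : Orientation k) → IsTrimLattice (_≈B_ {k} {o}) (_≤B_ {k} {o})
theorem9 k o = isTrimLattice (presentation o)
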